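{- $\mathfrak{s} \leq \text{\ss}$, where $\mathfrak{s}$ is the splitting number and $\text{\ss}$ is the subseries number.
   Context: $\mathbb{N}=\{1,2,3,\dots\}$. For $A\subseteq\mathbb{N}$, the subseries $\sum_{n\in A}a_n$ is summed in increasing order of the indices; if $A$ is finite it is a finite sum and counts as convergent. A series is conditionally convergent if it converges but not absolutely. The subseries number $\text{\ss}$ is the smallest cardinality of a family $\mathcal{A}$ of subsets of $\mathbb{N}$ such that for every conditionally convergent series $\sum_{n\in\mathbb{N}}a_n$ of real numbers there is $A\in\mathcal{A}$ such that $\sum_{n\in A}a_n$ diverges. For infinite $A,B\subseteq\mathbb{N}$, $A$ splits $B$ if both $B\cap A$ and $B\setminus A$ are infinite. The splitting number $\mathfrak{s}$ is the smallest cardinality of a family $\mathcal{A}$ of subsets of $\mathbb{N}$ such that every infinite $B\subseteq\mathbb{N}$ is split by some $A\in\mathcal{A}$. -}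

module Defs where

open import Data.Bool.Base using (Bool; true; T; if_then_else_)
open import Data.Nat.Base as ℕ using (ℕ; zero; suc)
import Data.Nat.Properties as ℕ
open import Data.Nat.InfinitelyOften using (Inf)
open import Data.Product.Base using (∃-syntax; _×_; _,_; proj₁)
open import Data.Sum.Base using (inj₁; inj₂)
open import Data.Rational.Base as ℚ using (ℚ; 0ℚ; ½)
import Data.Rational.Properties as ℚ
open import Data.Rational.Solver using (module +-*-Solver)
open import Function.Base using (_∘_; const)
open import Function.Bundles using (Bijection; Injection)
open import Level as Level using (0ℓ)
open import Relation.Binary.Bundles using (Setoid)
import Relation.Binary.Construct.On as On
open import Relation.Binary.PropositionalEquality
  using (_≡_; refl; sym; cong; subst; _→-setoid_)
open import Relation.Nullary.Negation using (¬_)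
open import Relation.Unary using (Pred; _∈_; _∩_; _∖_)

IsCauchy : (ℕ → ℚ) → Set
IsCauchy x = ∀ ε → 0ℚ ℚ.< ε →
  ∃[ N ] (∀ m n → N ℕ.≤ m → N ℕ.≤ n → ℚ.∣ x m ℚ.- x n ∣ ℚ.< ε)

record ℝ : Set where
  constructor mkℝ
  field
    approx : ℕ → ℚ
    cauchy : IsCauchy approx

open ℝ public

private
  0<½ε : ∀ ε → 0ℚ ℚ.< ε → 0ℚ ℚ.< ½ ℚ.* ε
  0<½ε ε 0<ε = subst (ℚ._< ½ ℚ.* ε) (ℚ.*-zeroʳ ½) (ℚ.*-monoʳ-<-pos ½ 0<ε)

  ½ε+½ε≡ε : ∀ ε → ½ ℚ.* ε ℚ.+ ½ ℚ.* ε ≡ ε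
  ½ε+½ε≡ε = solve 1 (λ e → con ½ :* e :+ con ½ :* e := e) refl
    where open +-*-Solver

  +-interchange-- : ∀ p q r s →
    (p ℚ.+ q) ℚ.- (r ℚ.+ s) ≡ (p ℚ.- r) ℚ.+ (q ℚ.- s)
  +-interchange-- =
    solve 4 (λ p q r s → (p :+ q) :- (r :+ s) := (p :- r) :+ (q :- s)) refl
    where open +-*-Solver

  neg-- : ∀ p q → (ℚ.- p) ℚ.- (ℚ.- q) ≡ ℚ.- (p ℚ.- q)
  neg-- = solve 2 (λ p q → (:- p) :- (:- q) := :- (p :- q)) refl
    where open +-*-Solver

  ∣p∣≤∣q∣+∣p-q∣ : ∀ p q → ℚ.∣ p ∣ ℚ.≤ ℚ.∣ q ∣ ℚ.+ ℚ.∣ p ℚ.- q ∣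
  ∣p∣≤∣q∣+∣p-q∣ p q = begin
    ℚ.∣ p ∣                       ≡⟨ cong ℚ.∣_∣ (lemma p q) ⟩
    ℚ.∣ q ℚ.+ (p ℚ.- q) ∣         ≤⟨ ℚ.∣p+q∣≤∣p∣+∣q∣ q (p ℚ.- q) ⟩
    ℚ.∣ q ∣ ℚ.+ ℚ.∣ p ℚ.- q ∣     ∎
    where
    open ℚ.≤-Reasoning
    open +-*-Solver
    lemma : ∀ p q → p ≡ q ℚ.+ (p ℚ.- q)
    lemma = solve 2 (λ p q → p := q :+ (p :- q)) refl

  ∣p-q∣≡∣q-p∣ : ∀ p q → ℚ.∣ p ℚ.- q ∣ ≡ ℚ.∣ q ℚ.- p ∣
  ∣p-q∣≡∣q-p∣ p q = begin-equality
    ℚ.∣ p ℚ.- q ∣            ≡⟨ cong ℚ.∣_∣ (lemma p q) ⟩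
    ℚ.∣ ℚ.- (q ℚ.- p) ∣      ≡⟨ ℚ.∣-p∣≡∣p∣ (q ℚ.- p) ⟩
    ℚ.∣ q ℚ.- p ∣            ∎
    where
    open ℚ.≤-Reasoning
    open +-*-Solver
    lemma : ∀ p q → p ℚ.- q ≡ ℚ.- (q ℚ.- p)
    lemma = solve 2 (λ p q → p :- q := :- (q :- p)) refl

  p≤q+r⇒p-q≤r : ∀ p q r → p ℚ.≤ q ℚ.+ r → p ℚ.- q ℚ.≤ r
  p≤q+r⇒p-q≤r p q r p≤q+r = begin
    p ℚ.- q            ≤⟨ ℚ.+-monoˡ-≤ (ℚ.- q) p≤q+r ⟩
    (q ℚ.+ r) ℚ.- q    ≡⟨ lemma q r ⟩
    r                  ∎
    where
    open ℚ.≤-Reasoning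
    open +-*-Solver
    lemma : ∀ q r → (q ℚ.+ r) ℚ.- q ≡ r
    lemma = solve 2 (λ q r → (q :+ r) :- q := r) refl

  ∣∣p∣-∣q∣∣≤∣p-q∣ : ∀ p q → ℚ.∣ ℚ.∣ p ∣ ℚ.- ℚ.∣ q ∣ ∣ ℚ.≤ ℚ.∣ p ℚ.- q ∣
  ∣∣p∣-∣q∣∣≤∣p-q∣ p q with ℚ.∣p∣≡p∨∣p∣≡-p (ℚ.∣ p ∣ ℚ.- ℚ.∣ q ∣)
  ... | inj₁ eq = begin
    ℚ.∣ ℚ.∣ p ∣ ℚ.- ℚ.∣ q ∣ ∣  ≡⟨ eq ⟩
    ℚ.∣ p ∣ ℚ.- ℚ.∣ q ∣        ≤⟨ p≤q+r⇒p-q≤r _ _ _ (∣p∣≤∣q∣+∣p-q∣ p q) ⟩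
    ℚ.∣ p ℚ.- q ∣              ∎
    where open ℚ.≤-Reasoning
  ... | inj₂ eq = begin
    ℚ.∣ ℚ.∣ p ∣ ℚ.- ℚ.∣ q ∣ ∣  ≡⟨ eq ⟩
    ℚ.- (ℚ.∣ p ∣ ℚ.- ℚ.∣ q ∣)  ≡⟨ lemma ℚ.∣ p ∣ ℚ.∣ q ∣ ⟩
    ℚ.∣ q ∣ ℚ.- ℚ.∣ p ∣        ≤⟨ p≤q+r⇒p-q≤r _ _ _ (∣p∣≤∣q∣+∣p-q∣ q p) ⟩
    ℚ.∣ q ℚ.- p ∣              ≡⟨ ∣p-q∣≡∣q-p∣ q p ⟩
    ℚ.∣ p ℚ.- q ∣              ∎
    where
    open ℚ.≤-Reasoning
    open +-*-Solver
    lemma : ∀ p q → ℚ.- (p ℚ.- q) ≡ q ℚ.- p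
    lemma = solve 2 (λ p q → :- (p :- q) := q :- p) refl

fromℚ : ℚ → ℝ
fromℚ q = mkℝ (const q) λ ε 0<ε →
  0 , λ _ _ _ _ → subst (ℚ._< ε) (cong ℚ.∣_∣ (sym (ℚ.+-inverseʳ q))) 0<ε

0ℝ : ℝ
0ℝ = fromℚ 0ℚ

infixl 6 _+_ _-_
infix  8 -_
infix  4 _<_

_+_ : ℝ → ℝ → ℝ
x + y = mkℝ (λ n → approx x n ℚ.+ approx y n) c
  where
  c : IsCauchy (λ n → approx x n ℚ.+ approx y n)
  c ε 0<ε with cauchy x (½ ℚ.* ε) (0<½ε ε 0<ε) | cauchy y (½ ℚ.* ε) (0<½ε ε 0<ε)
  ... | M , p | N , q = M ℕ.⊔ N , λ m n m≥ n≥ → begin-strict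
    ℚ.∣ (approx x m ℚ.+ approx y m) ℚ.- (approx x n ℚ.+ approx y n) ∣
      ≡⟨ cong ℚ.∣_∣ (+-interchange-- (approx x m) (approx y m) (approx x n) (approx y n)) ⟩
    ℚ.∣ (approx x m ℚ.- approx x n) ℚ.+ (approx y m ℚ.- approx y n) ∣
      ≤⟨ ℚ.∣p+q∣≤∣p∣+∣q∣ (approx x m ℚ.- approx x n) (approx y m ℚ.- approx y n) ⟩
    ℚ.∣ approx x m ℚ.- approx x n ∣ ℚ.+ ℚ.∣ approx y m ℚ.- approx y n ∣
      <⟨ ℚ.+-mono-<
           (p m n (ℕ.≤-trans (ℕ.m≤m⊔n M N) m≥) (ℕ.≤-trans (ℕ.m≤m⊔n M N) n≥))
           (q m n (ℕ.≤-trans (ℕ.m≤n⊔m M N) m≥) (ℕ.≤-trans (ℕ.m≤n⊔m M N) n≥)) ⟩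
    ½ ℚ.* ε ℚ.+ ½ ℚ.* ε
      ≡⟨ ½ε+½ε≡ε ε ⟩
    ε ∎
    where open ℚ.≤-Reasoning

-_ : ℝ → ℝ
- x = mkℝ (λ n → ℚ.- approx x n) c
  where
  c : IsCauchy (λ n → ℚ.- approx x n)
  c ε 0<ε with cauchy x ε 0<ε
  ... | N , p = N , λ m n m≥ n≥ → begin-strict
    ℚ.∣ (ℚ.- approx x m) ℚ.- (ℚ.- approx x n) ∣
      ≡⟨ cong ℚ.∣_∣ (neg-- (approx x m) (approx x n)) ⟩
    ℚ.∣ ℚ.- (approx x m ℚ.- approx x n) ∣
      ≡⟨ ℚ.∣-p∣≡∣p∣ (approx x m ℚ.- approx x n) ⟩
    ℚ.∣ approx x m ℚ.- approx x n ∣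
      <⟨ p m n m≥ n≥ ⟩
    ε ∎
    where open ℚ.≤-Reasoning

_-_ : ℝ → ℝ → ℝ
x - y = x + (- y)

∣_∣ : ℝ → ℝ
∣ x ∣ = mkℝ (λ n → ℚ.∣ approx x n ∣) c
  where
  c : IsCauchy (λ n → ℚ.∣ approx x n ∣)
  c ε 0<ε with cauchy x ε 0<ε
  ... | N , p = N , λ m n m≥ n≥ →
    ℚ.≤-<-trans (∣∣p∣-∣q∣∣≤∣p-q∣ (approx x m) (approx x n)) (p m n m≥ n≥)

-- A fixed rational gap is required: the termwise inequality of the
-- approximations would not respect equality of reals.
_<_ : ℝ → ℝ → Set
x < y = ∃[ q ] 0ℚ ℚ.< q ×
  ∃[ N ] (∀ n → N ℕ.≤ n → approx x n ℚ.+ q ℚ.≤ approx y n)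

_⟶_ : (ℕ → ℝ) → ℝ → Set
s ⟶ L = ∀ ε → 0ℝ < ε → ∃[ N ] (∀ n → N ℕ.≤ n → ∣ s n - L ∣ < ε)

Converges : (ℕ → ℝ) → Set
Converges s = ∃[ L ] s ⟶ L

-- Sets of natural numbers, by characteristic functions.  Under excluded
-- middle these are all the subsets of ℕ.

Subset : Set
Subset = ℕ → Bool

⟦_⟧ : Subset → Pred ℕ 0ℓ
⟦ A ⟧ = T ∘ A

full : Subset
full = const true

Infinite : Subset → Set
Infinite A = Inf ⟦ A ⟧

_splits_ : Subset → Subset → Set
A splits B = Inf (⟦ B ⟧ ∩ ⟦ A ⟧) × Inf (⟦ B ⟧ ∖ ⟦ A ⟧)

-- Indices start at 0: the term of index n here is
-- the term of index n + 1 when ℕ = {1, 2, 3, …}.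
--
-- The sum of the a i with i ∈ A and i < n, in increasing order of i.  As
-- n grows this runs through the partial sums of ∑_{i∈A} a i, with
-- repetitions, and is eventually constant if A is finite.
partialSum : Subset → (ℕ → ℝ) → ℕ → ℝ
partialSum A a zero    = 0ℝ
partialSum A a (suc n) =
  if A n then partialSum A a n + a n else partialSum A a n

SubseriesConverges : Subset → (ℕ → ℝ) → Set
SubseriesConverges A a = Converges (partialSum A a)

SeriesConverges : (ℕ → ℝ) → Set
SeriesConverges = SubseriesConverges full

ConditionallyConvergent : (ℕ → ℝ) → Set
ConditionallyConvergent a =
  SeriesConverges a × ¬ SeriesConverges (λ n → ∣ a n ∣)

-- A cardinal is represented by any set of that size; sets are setoids
-- because subsets of ℕ are compared extensionally.
Cardinal : Set₁
Cardinal = Setoid 0ℓ 0ℓ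

infix 4 _≤ᶜ_ _≈ᶜ_

_≤ᶜ_ : Cardinal → Cardinal → Set
κ ≤ᶜ μ = Injection κ μ

_≈ᶜ_ : Cardinal → Cardinal → Set
κ ≈ᶜ μ = Bijection κ μ

Family : Set₁
Family = Pred Subset 0ℓ

-- Two members of a family count as the same when they have the same
-- elements, whatever the proofs of membership in the family.
card : Family → Cardinal
card 𝒜 = On.setoid (ℕ →-setoid Bool) (proj₁ {B = 𝒜})

-- A relation rather than a function: that a minimum exists depends on the
-- axiom of choice.  It is unique up to bijection.
IsLeastCardinality : Pred Family 0ℓ → Cardinal → Set₁
IsLeastCardinality P κ =
  (∃[ 𝒜 ] P 𝒜 × card 𝒜 ≈ᶜ κ) × (∀ 𝒜 → P 𝒜 → κ ≤ᶜ card 𝒜)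

SplittingFamily : Pred Family 0ℓ
SplittingFamily 𝒜 = ∀ B → Infinite B → ∃[ A ] A ∈ 𝒜 × A splits B

SubseriesFamily : Pred Family 0ℓ
SubseriesFamily 𝒜 = ∀ a → ConditionallyConvergent a →
  ∃[ A ] A ∈ 𝒜 × ¬ SubseriesConverges A a

IsSplittingNumber : Pred Cardinal (Level.suc 0ℓ)
IsSplittingNumber = IsLeastCardinality SplittingFamily

IsSubseriesNumber : Pred Cardinal (Level.suc 0ℓ)
IsSubseriesNumber = IsLeastCardinality SubseriesFamily

{-# OPTIONS --safe #-}

-- A subseries family 𝒜 is itself a splitting family.  Given an infinite set
-- B, let the n-th partial sum be z (∣ B ∩ n ∣), where z runs through
-- 0, 1/2, 0, 1/4, 0, 1/6, …; its terms vanish off B.  The series converges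
-- to 0, but its variation dominates a tail of the harmonic series, so some
-- A ∈ 𝒜 yields a divergent subseries.  If A did not split B, then A would
-- contain almost none or almost all of B, so that from some index on the
-- partial sums along A would be constant or change as those of the full
-- series do; in both cases they would converge.
module Submission where

open import Axiom.ExcludedMiddle using (ExcludedMiddle)
open import Data.Bool.Base using (Bool; true; false; T; not; if_then_else_)
open import Data.Integer.Base as ℤ using (+_; +[1+_])
import Data.Integer.Properties as ℤ
open import Data.Integer.Solver using () renaming (module +-*-Solver to ℤ-Solver)
open import Data.Nat.Base as ℕ using (ℕ; zero; suc)
open import Data.Nat.InfinitelyOften using (Fin; Inf)
import Data.Nat.Properties as ℕ
open import Data.Nat.Solver using () renaming (module +-*-Solver to ℕ-Solver)
open import Data.Product.Base using (∃-syntax; _×_; _,_)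
open import Data.Rational.Base as ℚ using (ℚ; mkℚ; 0ℚ; ½; _/_)
import Data.Rational.Properties as ℚ
open import Data.Rational.Solver using (module +-*-Solver)
open import Data.Rational.Unnormalised.Base as ℚᵘ using (mkℚᵘ; *≡*; *≤*)
import Data.Rational.Unnormalised.Properties as ℚᵘ
open import Data.Sum.Base using (inj₁; inj₂)
open import Data.Unit.Base using (tt)
open import Function.Base using (_∘_; const; id)
open import Function.Bundles using (Bijection)
import Function.Construct.Composition as Composition
open import Level using (0ℓ)
open import Relation.Binary.PropositionalEquality
open import Relation.Nullary.Decidable using (Dec; yes; no; T?; decidable-stable)
open import Relation.Nullary.Negation using (¬_; contradiction)
open import Relation.Unary using (_∩_; _∖_)

open import Defs

≤-induction : (P : ℕ → Set) (N : ℕ) → P N →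
  (∀ n → N ℕ.≤ n → P n → P (suc n)) → ∀ n → N ℕ.≤ n → P n
≤-induction P N base step n N≤n = go (ℕ.≤⇒≤′ N≤n)
  where
  go : ∀ {n} → N ℕ.≤′ n → P n
  go ℕ.≤′-refl       = base
  go (ℕ.≤′-step N≤n) = step _ (ℕ.≤′⇒≤ N≤n) (go N≤n)

-- Rational arithmetic

-- `_/_` reduces to lowest terms, so both sides pass to unnormalised rationals, where the order is
-- cross multiplication by definition.
/-mono-≤ : ∀ a m b n → a ℕ.* suc n ℕ.≤ b ℕ.* suc m → + a / suc m ℚ.≤ + b / suc n
/-mono-≤ a m b n le = ℚ.toℚᵘ-cancel-≤ (begin
  ℚ.toℚᵘ (+ a / suc m)   ≃⟨ ℚ.toℚᵘ-fromℚᵘ (mkℚᵘ (+ a) m) ⟩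
  mkℚᵘ (+ a) m           ≤⟨ *≤* (subst₂ ℤ._≤_ (ℤ.pos-* a (suc n)) (ℤ.pos-* b (suc m)) (ℤ.+≤+ le)) ⟩
  mkℚᵘ (+ b) n           ≃⟨ ℚ.toℚᵘ-fromℚᵘ (mkℚᵘ (+ b) n) ⟨
  ℚ.toℚᵘ (+ b / suc n)   ∎)
  where open ℚᵘ.≤-Reasoning

/-distribʳ-+ : ∀ a b m → + (a ℕ.+ b) / suc m ≡ + a / suc m ℚ.+ + b / suc m
/-distribʳ-+ a b m = ℚ.toℚᵘ-injective (begin
  ℚ.toℚᵘ (+ (a ℕ.+ b) / suc m)
    ≈⟨ ℚ.toℚᵘ-fromℚᵘ (mkℚᵘ (+ (a ℕ.+ b)) m) ⟩
  mkℚᵘ (+ (a ℕ.+ b)) m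
    ≈⟨ *≡* (lemma (+ a) (+ b) (+ suc m)) ⟩
  mkℚᵘ (+ a) m ℚᵘ.+ mkℚᵘ (+ b) m
    ≈⟨ ℚᵘ.+-cong (ℚ.toℚᵘ-fromℚᵘ (mkℚᵘ (+ a) m)) (ℚ.toℚᵘ-fromℚᵘ (mkℚᵘ (+ b) m)) ⟨
  ℚ.toℚᵘ (+ a / suc m) ℚᵘ.+ ℚ.toℚᵘ (+ b / suc m)
    ≈⟨ ℚ.toℚᵘ-homo-+ (+ a / suc m) (+ b / suc m) ⟨
  ℚ.toℚᵘ (+ a / suc m ℚ.+ + b / suc m) ∎)
  where
  open import Relation.Binary.Reasoning.Setoid ℚᵘ.≃-setoid
  open ℤ-Solver
  lemma : ∀ a b s → (a ℤ.+ b) ℤ.* (s ℤ.* s) ≡ (a ℤ.* s ℤ.+ b ℤ.* s) ℤ.* s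
  lemma = solve 3 (λ a b s → (a :+ b) :* (s :* s) := (a :* s :+ b :* s) :* s) refl

0≤1/ : ∀ m → 0ℚ ℚ.≤ + 1 / suc m
0≤1/ m = /-mono-≤ 0 0 1 m ℕ.z≤n

1/-antitone : ∀ {m n} → m ℕ.≤ n → + 1 / suc n ℚ.≤ + 1 / suc m
1/-antitone {m} {n} m≤n = /-mono-≤ 1 n 1 m (ℕ.*-monoʳ-≤ 1 (ℕ.s≤s m≤n))

-- The denominator of `ε` itself serves: a positive numerator is at least 1.
archimedean : ∀ ε → 0ℚ ℚ.< ε → ∃[ k ] + 1 / suc k ℚ.≤ ε
archimedean ε 0<ε with ε | ℚ.positive 0<ε
... | p@(mkℚ +[1+ n ] d _) | _ = d , (begin
  + 1 / suc d       ≤⟨ /-mono-≤ 1 d (suc n) d (ℕ.*-monoˡ-≤ (suc d) {1} {suc n} (ℕ.s≤s ℕ.z≤n)) ⟩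
  + suc n / suc d   ≡⟨ ℚ.↥p/↧p≡p p ⟩
  p                 ∎)
  where open ℚ.≤-Reasoning

-- Since `m` is at least 2k + 1, twice m - k is at least m + 1. This yields the jump of `½` that
-- refutes absolute convergence.
½+k/≤m/ : ∀ k m → k ℕ.+ k ℕ.< m → ½ ℚ.+ + k / suc m ℚ.≤ + m / suc m
½+k/≤m/ k m 2k<m with ℕ.m≤n⇒∃[o]m+o≡n 2k<m
... | r , refl = begin
  ½ ℚ.+ + k / suc m
    ≤⟨ ℚ.+-monoˡ-≤ (+ k / suc m) (/-mono-≤ 1 1 (suc (k ℕ.+ r)) m half) ⟩
  + suc (k ℕ.+ r) / suc m ℚ.+ + k / suc m
    ≡⟨ /-distribʳ-+ (suc (k ℕ.+ r)) k m ⟨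
  + (suc (k ℕ.+ r) ℕ.+ k) / suc m
    ≡⟨ cong (λ a → + a / suc m) (reorder k r) ⟩
  + m / suc m ∎
  where
  open ℚ.≤-Reasoning
  open ℕ-Solver
  reorder : ∀ k r → suc (k ℕ.+ r) ℕ.+ k ≡ suc (k ℕ.+ k) ℕ.+ r
  reorder = solve 2 (λ k r → con 1 :+ (k :+ r) :+ k := con 1 :+ (k :+ k) :+ r) refl

  double : ∀ k r → 1 ℕ.* suc (suc (k ℕ.+ k) ℕ.+ r) ℕ.+ r ≡ suc (k ℕ.+ r) ℕ.* 2
  double = solve 2 (λ k r →
    con 1 :* (con 2 :+ (k :+ k) :+ r) :+ r := (con 1 :+ (k :+ r)) :* con 2) refl

  half : 1 ℕ.* suc m ℕ.≤ suc (k ℕ.+ r) ℕ.* 2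
  half = subst (1 ℕ.* suc m ℕ.≤_) (double k r) (ℕ.m≤m+n _ r)

∣p-0∣≡∣p∣ : ∀ p → ℚ.∣ p ℚ.- 0ℚ ∣ ≡ ℚ.∣ p ∣
∣p-0∣≡∣p∣ p = cong ℚ.∣_∣ (ℚ.+-identityʳ p)

∣0-p∣≡∣p∣ : ∀ p → ℚ.∣ 0ℚ ℚ.- p ∣ ≡ ℚ.∣ p ∣
∣0-p∣≡∣p∣ p = trans (cong ℚ.∣_∣ (ℚ.+-identityˡ (ℚ.- p))) (ℚ.∣-p∣≡∣p∣ p)

p≤∣p∣ : ∀ p → p ℚ.≤ ℚ.∣ p ∣
p≤∣p∣ p with ℚ.≤-total 0ℚ p
... | inj₁ 0≤p = ℚ.≤-reflexive (sym (ℚ.0≤p⇒∣p∣≡p 0≤p))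
... | inj₂ p≤0 = ℚ.≤-trans p≤0 (ℚ.0≤∣p∣ p)

p≤q+∣p-q∣ : ∀ p q → p ℚ.≤ q ℚ.+ ℚ.∣ p ℚ.- q ∣
p≤q+∣p-q∣ p q = begin
  p                       ≡⟨ lemma p q ⟩
  q ℚ.+ (p ℚ.- q)         ≤⟨ ℚ.+-monoʳ-≤ q (p≤∣p∣ (p ℚ.- q)) ⟩
  q ℚ.+ ℚ.∣ p ℚ.- q ∣     ∎
  where
  open ℚ.≤-Reasoning
  open +-*-Solver
  lemma : ∀ p q → p ≡ q ℚ.+ (p ℚ.- q)
  lemma = solve 2 (λ p q → p := q :+ (p :- q)) refl

∣p-q∣≡∣q-p∣ : ∀ p q → ℚ.∣ p ℚ.- q ∣ ≡ ℚ.∣ q ℚ.- p ∣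
∣p-q∣≡∣q-p∣ p q = trans (cong ℚ.∣_∣ (lemma p q)) (ℚ.∣-p∣≡∣p∣ (q ℚ.- p))
  where
  open +-*-Solver
  lemma : ∀ p q → p ℚ.- q ≡ ℚ.- (q ℚ.- p)
  lemma = solve 2 (λ p q → p :- q := :- (q :- p)) refl

p+r≤q⇒p<q : ∀ p q r → 0ℚ ℚ.< r → p ℚ.+ r ℚ.≤ q → p ℚ.< q
p+r≤q⇒p<q p q r 0<r p+r≤q = ℚ.<-≤-trans
  (subst (ℚ._< p ℚ.+ r) (ℚ.+-identityʳ p) (ℚ.+-monoʳ-< p 0<r)) p+r≤q

closeToSame : ∀ p q r ε → ℚ.∣ p ℚ.- r ∣ ℚ.< ε → ℚ.∣ q ℚ.- r ∣ ℚ.< ε →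
  p ℚ.< q ℚ.+ (ε ℚ.+ ε)
closeToSame p q r ε p~r q~r = begin-strict
  p
    ≤⟨ p≤q+∣p-q∣ p r ⟩
  r ℚ.+ ℚ.∣ p ℚ.- r ∣
    ≤⟨ ℚ.+-monoˡ-≤ ℚ.∣ p ℚ.- r ∣ (p≤q+∣p-q∣ r q) ⟩
  q ℚ.+ ℚ.∣ r ℚ.- q ∣ ℚ.+ ℚ.∣ p ℚ.- r ∣
    ≡⟨ ℚ.+-assoc q ℚ.∣ r ℚ.- q ∣ ℚ.∣ p ℚ.- r ∣ ⟩
  q ℚ.+ (ℚ.∣ r ℚ.- q ∣ ℚ.+ ℚ.∣ p ℚ.- r ∣)
    ≡⟨ cong (λ z → q ℚ.+ (z ℚ.+ ℚ.∣ p ℚ.- r ∣)) (∣p-q∣≡∣q-p∣ r q) ⟩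
  q ℚ.+ (ℚ.∣ q ℚ.- r ∣ ℚ.+ ℚ.∣ p ℚ.- r ∣)
    <⟨ ℚ.+-monoʳ-< q (ℚ.+-mono-< q~r p~r) ⟩
  q ℚ.+ (ε ℚ.+ ε) ∎
  where open ℚ.≤-Reasoning

-- Recasts one step of a partial sum as adding `r` unconditionally, so that it can be matched with
-- the increment of another sequence.
if-+ : ∀ b p q r → (T b → q ≡ r) → (¬ T b → r ≡ 0ℚ) →
  (if b then p ℚ.+ q else p) ≡ p ℚ.+ r
if-+ true  p q r q≡r _   = cong (p ℚ.+_) (q≡r tt)
if-+ false p q r _   r≡0 = sym (trans (cong (p ℚ.+_) (r≡0 id)) (ℚ.+-identityʳ p))

+-mono-≤-interchange : ∀ p q r s t u → q ℚ.≤ t → p ℚ.+ r ℚ.≤ s ℚ.+ u →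
  p ℚ.+ (q ℚ.+ r) ℚ.≤ s ℚ.+ t ℚ.+ u
+-mono-≤-interchange p q r s t u q≤t p+r≤s+u = begin
  p ℚ.+ (q ℚ.+ r)     ≡⟨ rotate p q r ⟩
  q ℚ.+ (p ℚ.+ r)     ≤⟨ ℚ.+-mono-≤ q≤t p+r≤s+u ⟩
  t ℚ.+ (s ℚ.+ u)     ≡⟨ rotate s t u ⟨
  s ℚ.+ (t ℚ.+ u)     ≡⟨ ℚ.+-assoc s t u ⟨
  s ℚ.+ t ℚ.+ u       ∎
  where
  open ℚ.≤-Reasoning
  open +-*-Solver
  rotate : ∀ a b c → a ℚ.+ (b ℚ.+ c) ≡ b ℚ.+ (a ℚ.+ c)
  rotate = solve 3 (λ a b c → a :+ (b :+ c) := b :+ (a :+ c)) refl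

<-+-≤-contradiction : ∀ p q r s t →
  p ℚ.< q ℚ.+ r → r ℚ.+ s ℚ.≤ t → ¬ (q ℚ.+ t ℚ.≤ p ℚ.+ s)
<-+-≤-contradiction p q r s t p<q+r r+s≤t q+t≤p+s = ℚ.<-irrefl refl (begin-strict
  q ℚ.+ t             ≤⟨ q+t≤p+s ⟩
  p ℚ.+ s             <⟨ ℚ.+-monoˡ-< s p<q+r ⟩
  q ℚ.+ r ℚ.+ s       ≡⟨ ℚ.+-assoc q r s ⟩
  q ℚ.+ (r ℚ.+ s)     ≤⟨ ℚ.+-monoʳ-≤ q r+s≤t ⟩
  q ℚ.+ t             ∎)
  where open ℚ.≤-Reasoning

-- Convergence of sequences of rationals

infix 4 _⟶ℚ_

_⟶ℚ_ : (ℕ → ℚ) → ℚ → Set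
x ⟶ℚ l = ∀ ε → 0ℚ ℚ.< ε → ∃[ N ] (∀ n → N ℕ.≤ n → ℚ.∣ x n ℚ.- l ∣ ℚ.≤ ε)

const-⟶ℚ : ∀ l → const l ⟶ℚ l
const-⟶ℚ l ε 0<ε = 0 , λ _ _ →
  subst (ℚ._≤ ε) (cong ℚ.∣_∣ (sym (ℚ.+-inverseʳ l))) (ℚ.<⇒≤ 0<ε)

-- From `N` on, `x` and `y` differ by the constant `d`, which shifts the limit.
sameIncrements-⟶ℚ : ∀ {x y l N} →
  (∀ n → N ℕ.≤ n → x (suc n) ≡ x n ℚ.+ (y (suc n) ℚ.- y n)) →
  y ⟶ℚ l → ∃[ l′ ] x ⟶ℚ l′
sameIncrements-⟶ℚ {x} {y} {l} {N} step y⟶l = l ℚ.+ d , conv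
  where
  open +-*-Solver
  d : ℚ
  d = x N ℚ.- y N

  init : ∀ p q → p ≡ q ℚ.+ (p ℚ.- q)
  init = solve 2 (λ p q → p := q :+ (p :- q)) refl

  next : ∀ p q d → (p ℚ.+ d) ℚ.+ (q ℚ.- p) ≡ q ℚ.+ d
  next = solve 3 (λ p q d → (p :+ d) :+ (q :- p) := q :+ d) refl

  cancel : ∀ p l d → (p ℚ.+ d) ℚ.- (l ℚ.+ d) ≡ p ℚ.- l
  cancel = solve 3 (λ p l d → (p :+ d) :- (l :+ d) := p :- l) refl

  shifted : ∀ n → N ℕ.≤ n → x n ≡ y n ℚ.+ d
  shifted = ≤-induction (λ n → x n ≡ y n ℚ.+ d) N (init (x N) (y N)) λ n N≤n eq →
    trans (step n N≤n)
      (trans (cong (ℚ._+ (y (suc n) ℚ.- y n)) eq) (next (y n) (y (suc n)) d))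

  conv : x ⟶ℚ l ℚ.+ d
  conv ε 0<ε with y⟶l ε 0<ε
  ... | M , h = M ℕ.⊔ N , λ n ≥ →
    subst (λ z → ℚ.∣ z ∣ ℚ.≤ ε)
      (sym (trans (cong (ℚ._- (l ℚ.+ d)) (shifted n (ℕ.m⊔n≤o⇒n≤o M N ≥))) (cancel (y n) l d)))
      (h n (ℕ.m⊔n≤o⇒m≤o M N ≥))

-- Transfer between real and rational sequences

infix 4 _≋_

-- Exact equality of all approximations is attainable: the terms are embedded rationals, and the
-- operations on `ℝ` act on approximations index by index.
_≋_ : (ℕ → ℝ) → (ℕ → ℚ) → Set
x ≋ q = ∀ n i → approx (x n) i ≡ q n

⟶ℚ⇒Converges : ∀ {x q l} → x ≋ q → q ⟶ℚ l → Converges x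
⟶ℚ⇒Converges {x} {q} {l} x≋q q⟶l = fromℚ l , conv
  where
  open ℚ.≤-Reasoning
  open +-*-Solver
  halves : ∀ p → ½ ℚ.* p ℚ.+ ½ ℚ.* p ≡ p
  halves = solve 1 (λ p → con ½ :* p :+ con ½ :* p := p) refl

  0<½* : ∀ {p} → 0ℚ ℚ.< p → 0ℚ ℚ.< ½ ℚ.* p
  0<½* {p} 0<p = subst (ℚ._< ½ ℚ.* p) (ℚ.*-zeroʳ ½) (ℚ.*-monoʳ-<-pos ½ 0<p)

  conv : x ⟶ fromℚ l
  -- Half of the gap `p` between 0 and `ε` bounds the distance to `l`; the other half is the gap
  -- that strict inequality of reals demands.
  conv ε (p , 0<p , I , h) with q⟶l (½ ℚ.* p) (0<½* 0<p)
  ... | N , k = N , λ n N≤n → ½ ℚ.* p , 0<½* 0<p , I , λ i I≤i → begin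
    ℚ.∣ approx (x n) i ℚ.- l ∣ ℚ.+ ½ ℚ.* p
      ≡⟨ cong (λ z → ℚ.∣ z ℚ.- l ∣ ℚ.+ ½ ℚ.* p) (x≋q n i) ⟩
    ℚ.∣ q n ℚ.- l ∣ ℚ.+ ½ ℚ.* p
      ≤⟨ ℚ.+-monoˡ-≤ (½ ℚ.* p) (k n N≤n) ⟩
    ½ ℚ.* p ℚ.+ ½ ℚ.* p
      ≡⟨ halves p ⟩
    p
      ≡⟨ ℚ.+-identityˡ p ⟨
    0ℚ ℚ.+ p
      ≤⟨ h i I≤i ⟩
    approx ε i ∎

-- A one-sided Cauchy condition, free of the limit; this is all that is needed to bound the growth
-- of the variation.
Converges⇒eventuallyClose : ∀ {x q} → x ≋ q → Converges x → ∀ ε → 0ℚ ℚ.< ε →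
  ∃[ N ] (∀ n → N ℕ.≤ n → q n ℚ.< q N ℚ.+ (ε ℚ.+ ε))
Converges⇒eventuallyClose {x} {q} x≋q (L , x⟶L) ε 0<ε
  with x⟶L (fromℚ ε) (ε , 0<ε , 0 , λ _ _ → ℚ.≤-reflexive (ℚ.+-identityˡ ε))
... | N , close = N , bound
  where
  near : ∀ n → ∣ x n - L ∣ < fromℚ ε →
    ∃[ I ] (∀ i → I ℕ.≤ i → ℚ.∣ q n ℚ.- approx L i ∣ ℚ.< ε)
  near n (p , 0<p , I , h) = I , λ i I≤i →
    p+r≤q⇒p<q ℚ.∣ q n ℚ.- approx L i ∣ ε p 0<p
      (subst (λ z → ℚ.∣ z ℚ.- approx L i ∣ ℚ.+ p ℚ.≤ ε) (x≋q n i) (h i I≤i))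

  bound : ∀ n → N ℕ.≤ n → q n ℚ.< q N ℚ.+ (ε ℚ.+ ε)
  bound n N≤n with near n (close n N≤n) | near N (close N ℕ.≤-refl)
  -- Both estimates must use the same approximation of `L`, hence the maximum of the two indices.
  ... | I , h | I′ , h′ = closeToSame (q n) (q N) (approx L (I ℕ.⊔ I′)) ε
    (h (I ℕ.⊔ I′) (ℕ.m≤m⊔n I I′)) (h′ (I ℕ.⊔ I′) (ℕ.m≤n⊔m I I′))

partialSumℚ : Subset → (ℕ → ℚ) → ℕ → ℚ
partialSumℚ A q zero    = 0ℚ
partialSumℚ A q (suc n) =
  if A n then partialSumℚ A q n ℚ.+ q n else partialSumℚ A q n

approx-if : ∀ b {x y p q i} → approx x i ≡ p → approx y i ≡ q →
  approx (if b then x else y) i ≡ (if b then p else q)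
approx-if true  x≡p _   = x≡p
approx-if false _   y≡q = y≡q

partialSum-≋ : ∀ {a q} A → a ≋ q → partialSum A a ≋ partialSumℚ A q
partialSum-≋ A a≋q zero    i = refl
partialSum-≋ {a} {q} A a≋q (suc n) i =
  approx-if (A n) {partialSum A a n + a n} {partialSum A a n}
    (cong₂ ℚ._+_ (partialSum-≋ A a≋q n i) (a≋q n i)) (partialSum-≋ A a≋q n i)

-- Counting the elements of a set

count : Subset → ℕ → ℕ
count B zero    = 0
count B (suc n) = if B n then suc (count B n) else count B n

count-suc : ∀ B n → count B n ℕ.≤ count B (suc n)
count-suc B n with B n
... | true  = ℕ.n≤1+n _
... | false = ℕ.≤-refl

count-∈ : ∀ B n → T (B n) → count B (suc n) ≡ suc (count B n)
count-∈ B n n∈B with B n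
... | true = refl

count-∉ : ∀ B n → ¬ T (B n) → count B (suc n) ≡ count B n
count-∉ B n n∉B with B n
... | true  = contradiction tt n∉B
... | false = refl

count-mono : ∀ B {m n} → m ℕ.≤ n → count B m ℕ.≤ count B n
count-mono B {m} {n} = ≤-induction (λ n → count B m ℕ.≤ count B n) m ℕ.≤-refl
  (λ n _ h → ℕ.≤-trans h (count-suc B n)) n

-- `Inf` is only the negation of `Fin`; excluded middle extracts an actual element.
Inf⇒beyond : ExcludedMiddle 0ℓ → ∀ {P : ℕ → Set} → Inf P → ∀ N → ∃[ n ] N ℕ.≤ n × P n
Inf⇒beyond em inf N = decidable-stable em λ none →
  inf (N , λ n N≤n Pn → none (n , N≤n , Pn))

count-unbounded : ExcludedMiddle 0ℓ → ∀ B → Infinite B → ∀ k → ∃[ N ] k ℕ.≤ count B N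
count-unbounded em B inf zero = 0 , ℕ.z≤n
count-unbounded em B inf (suc k) with count-unbounded em B inf k
... | N , k≤ with Inf⇒beyond em inf N
... | n , N≤n , n∈B = suc n ,
  subst (suc k ℕ.≤_) (sym (count-∈ B n n∈B)) (ℕ.s≤s (ℕ.≤-trans k≤ (count-mono B N≤n)))

-- The zigzag series along a set

odd : ℕ → Bool
odd zero    = false
odd (suc k) = not (odd k)

zigzag : ℕ → ℚ
zigzag k = if odd k then + 1 / suc k else 0ℚ

zigzag-bound : ∀ k → ℚ.∣ zigzag k ℚ.- 0ℚ ∣ ℚ.≤ + 1 / suc k
zigzag-bound k with odd k
... | true  = ℚ.≤-reflexive (trans (∣p-0∣≡∣p∣ _) (ℚ.0≤p⇒∣p∣≡p (0≤1/ k)))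
... | false = 0≤1/ k

-- Of two neighbouring values one is 0 and the other is the reciprocal of `suc k` or `suc (suc k)`;
-- the smaller reciprocal bounds both cases.
zigzag-jump : ∀ k → + 1 / suc (suc k) ℚ.≤ ℚ.∣ zigzag (suc k) ℚ.- zigzag k ∣
zigzag-jump k with odd k
... | true  = begin
  + 1 / suc (suc k)              ≤⟨ 1/-antitone (ℕ.n≤1+n k) ⟩
  + 1 / suc k                    ≡⟨ ℚ.0≤p⇒∣p∣≡p (0≤1/ k) ⟨
  ℚ.∣ + 1 / suc k ∣              ≡⟨ ∣0-p∣≡∣p∣ _ ⟨
  ℚ.∣ 0ℚ ℚ.- + 1 / suc k ∣       ∎
  where open ℚ.≤-Reasoning
... | false = ℚ.≤-reflexive
  (sym (trans (∣p-0∣≡∣p∣ _) (ℚ.0≤p⇒∣p∣≡p (0≤1/ (suc k)))))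

module ZigzagAlong (em : ExcludedMiddle 0ℓ) (B : Subset) (inf : Infinite B) where

  sums : ℕ → ℚ
  sums n = zigzag (count B n)

  term : ℕ → ℚ
  term n = sums (suc n) ℚ.- sums n

  variation : ℕ → ℚ
  variation = partialSumℚ full (ℚ.∣_∣ ∘ term)

  series : ℕ → ℝ
  series = fromℚ ∘ term

  term-outside : ∀ n → ¬ T (B n) → term n ≡ 0ℚ
  term-outside n n∉B = trans
    (cong (λ c → zigzag c ℚ.- sums n) (count-∉ B n n∉B)) (ℚ.+-inverseʳ (sums n))

  term-inside : ∀ n → T (B n) → + 1 / suc (count B (suc n)) ℚ.≤ ℚ.∣ term n ∣
  term-inside n n∈B = subst
    (λ c → + 1 / suc c ℚ.≤ ℚ.∣ zigzag c ℚ.- sums n ∣)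
    (sym (count-∈ B n n∈B)) (zigzag-jump (count B n))

  sums⟶0 : sums ⟶ℚ 0ℚ
  sums⟶0 ε 0<ε with archimedean ε 0<ε
  ... | k , 1/k≤ε with count-unbounded em B inf k
  ... | N , k≤ = N , λ n N≤n → ℚ.≤-trans (zigzag-bound (count B n))
    (ℚ.≤-trans (1/-antitone (ℕ.≤-trans k≤ (count-mono B N≤n))) 1/k≤ε)

  subseries : Subset → ℕ → ℚ
  subseries A = partialSumℚ A term

  -- Every term still added beyond `N` lies off `B` and vanishes, so the comparison sequence is
  -- constant.
  almostDisjoint⇒Converges : ∀ A → Fin (T ∘ B ∩ T ∘ A) → SubseriesConverges A series
  almostDisjoint⇒Converges A (N , none) =
    let l , conv = sameIncrements-⟶ℚ {subseries A} {const 0ℚ} {0ℚ} step (const-⟶ℚ 0ℚ)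
    in ⟶ℚ⇒Converges {partialSum A series} {subseries A} {l} (partialSum-≋ A (λ _ _ → refl)) conv
    where
    -- The difference is the increment of `const 0ℚ` and computes to `0ℚ`.
    step : ∀ n → N ℕ.≤ n → subseries A (suc n) ≡ subseries A n ℚ.+ (0ℚ ℚ.- 0ℚ)
    step n N≤n = if-+ (A n) (subseries A n) (term n) 0ℚ
      (λ n∈A → term-outside n λ n∈B → none n N≤n (n∈B , n∈A)) (λ _ → refl)

  -- Every term skipped beyond `N` lies off `B` and vanishes, so the increments are those of `sums`.
  almostContained⇒Converges : ∀ A → Fin (T ∘ B ∖ T ∘ A) → SubseriesConverges A series
  almostContained⇒Converges A (N , none) =
    let l , conv = sameIncrements-⟶ℚ {subseries A} {sums} {0ℚ} step sums⟶0
    in ⟶ℚ⇒Converges {partialSum A series} {subseries A} {l} (partialSum-≋ A (λ _ _ → refl)) conv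
    where
    step : ∀ n → N ℕ.≤ n → subseries A (suc n) ≡ subseries A n ℚ.+ term n
    step n N≤n = if-+ (A n) (subseries A n) (term n) (term n) (λ _ → refl)
      (λ n∉A → term-outside n λ n∈B → none n N≤n (n∈B , n∉A))

  -- As long as count B n ≤ m, each new element of B adds at least 1 / suc m
  -- to the variation.
  variation-growth : ∀ m N n → N ℕ.≤ n → count B n ℕ.≤ m →
    variation N ℚ.+ + count B n / suc m ℚ.≤ variation n ℚ.+ + count B N / suc m
  variation-growth m N = ≤-induction P N (λ _ → ℚ.≤-refl) (λ n _ → step n (T? (B n)))
    where
    P : ℕ → Set
    P n = count B n ℕ.≤ m →
      variation N ℚ.+ + count B n / suc m ℚ.≤ variation n ℚ.+ + count B N / suc m

    step : ∀ n → Dec (T (B n)) → P n → P (suc n)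
    step n (yes n∈B) ih ≤m = subst
      (λ p → variation N ℚ.+ p ℚ.≤ variation (suc n) ℚ.+ + count B N / suc m)
      (trans (sym (/-distribʳ-+ 1 (count B n) m)) (cong (λ c → + c / suc m) (sym (count-∈ B n n∈B))))
      (+-mono-≤-interchange (variation N) (+ 1 / suc m) (+ count B n / suc m)
        (variation n) ℚ.∣ term n ∣ (+ count B N / suc m)
        (ℚ.≤-trans (1/-antitone ≤m) (term-inside n n∈B))
        (ih (ℕ.≤-trans (count-suc B n) ≤m)))
    step n (no n∉B) ih ≤m = subst
      (λ p → variation N ℚ.+ p ℚ.≤ variation (suc n) ℚ.+ + count B N / suc m)
      (trans (ℚ.+-identityˡ (+ count B n / suc m)) (cong (λ c → + c / suc m) (sym (count-∉ B n n∉B))))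
      (+-mono-≤-interchange (variation N) 0ℚ (+ count B n / suc m)
        (variation n) ℚ.∣ term n ∣ (+ count B N / suc m)
        (ℚ.0≤∣p∣ (term n))
        (ih (ℕ.≤-trans (count-suc B n) ≤m)))

  ¬absolutelyConvergent : ¬ SeriesConverges (λ n → ∣ series n ∣)
  ¬absolutelyConvergent conv =
    -- The tolerance 1/4 is doubled to `½`, so the variation would grow by less than `½` after `N`.
    -- Once the count exceeds twice `k`, it has grown by at least (m - k)/(m + 1), hence by `½`.
    let N , close = Converges⇒eventuallyClose
          {partialSum full (λ n → ∣ series n ∣)} {variation}
          (partialSum-≋ full (λ _ _ → refl)) conv (+ 1 / 4) (ℚ.positive⁻¹ (+ 1 / 4))
        k = count B N
        n , 2k<c = count-unbounded em B inf (suc (k ℕ.+ k))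
        M = N ℕ.⊔ n
        m = count B M
    in <-+-≤-contradiction (variation M) (variation N) ½ (+ k / suc m) (+ m / suc m)
         (close M (ℕ.m≤m⊔n N n))
         (½+k/≤m/ k m (ℕ.≤-trans 2k<c (count-mono B (ℕ.m≤n⊔m N n))))
         (variation-growth m N M (ℕ.m≤m⊔n N n) ℕ.≤-refl)

  conditionallyConvergent : ConditionallyConvergent series
  conditionallyConvergent =
    -- The whole series is the subseries along `full`, which misses no element of `B`.
    almostContained⇒Converges full (0 , λ _ _ (_ , n∉) → n∉ tt) , ¬absolutelyConvergent

-- Comparison of the two cardinals

subseriesFamily⇒splittingFamily : ExcludedMiddle 0ℓ →
  ∀ {𝒜} → SubseriesFamily 𝒜 → SplittingFamily 𝒜
subseriesFamily⇒splittingFamily em sub B inf =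
  let A , A∈𝒜 , div = sub series conditionallyConvergent
  -- Splitting unfolds to two negated `Fin` statements, so each half is the contrapositive of a
  -- convergence lemma.
  in  A , A∈𝒜 , div ∘ almostDisjoint⇒Converges A , div ∘ almostContained⇒Converges A
  where open ZigzagAlong em B inf

theorem7 : ExcludedMiddle 0ℓ →
    ∀ (𝔰 ß : Cardinal) → IsSplittingNumber 𝔰 → IsSubseriesNumber ß → 𝔰 ≤ᶜ ß
theorem7 em 𝔰 ß (_ , least) ((𝒜 , sub , 𝒜≈ß) , _) =
  -- `𝒜` is a subseries family of size `ß`; minimality of `𝔰` applies to it as a splitting family.
  Composition.injection (least 𝒜 (subseriesFamily⇒splittingFamily em sub))
    (Bijection.injection 𝒜≈ß)
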